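{- There exist a planar, 3-connected, non-complete graph $G$ with $d(S_5)=4$ and a list assignment $L$ with $|L(v)|=\min\{d(v),5\}$ for all $v\in V(G)$ such that $G$ is not $L$-colorable.
   Context: For a graph $G$, $d(v)$ denotes the degree of $v$. $S_5=\{v\in V(G): d(v)<5\}$, and $d(S_5)$ denotes the smallest distance in $G$ between two distinct connected components of the induced subgraph $G[S_5]$; if $G[S_5]$ has at most one component, $d(S_5)=0$. A list assignment $L$ assigns a set $L(v)$ of colors to each vertex; $G$ is $L$-colorable if there is a proper coloring $\varphi$ with $\varphi(v)\in L(v)$ for all $v$. -}

module Defs where

open import Data.Nat as ℕ using (ℕ; zero; suc; _⊓_)
open import Data.Integer as ℤ using (ℤ; 0ℤ; _-_; _*_; _<_; _≤_)
open import Data.Fin using (Fin)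
open import Data.Bool using (Bool; true; false; if_then_else_)
open import Data.List using (List; length; map; allFin)
open import Data.Nat.ListAction using (sum)
open import Data.List.Membership.Propositional using (_∈_; _∉_)
open import Data.List.Relation.Unary.Unique.Propositional using (Unique)
open import Data.Product using (Σ; ∃; _×_; _,_)
open import Data.Sum using (_⊎_)
open import Relation.Binary.PropositionalEquality using (_≡_; _≢_)
open import Relation.Nullary using (¬_)

record Graph : Set where
  field
    n      : ℕ
    adj    : Fin n → Fin n → Bool
    sym    : ∀ u v → adj u v ≡ adj v u
    irrefl : ∀ v → adj v v ≡ false

open Graph public

Adj : (G : Graph) → Fin (n G) → Fin (n G) → Set
Adj G u v = adj G u v ≡ true

degree : (G : Graph) → Fin (n G) → ℕ
degree G v = sum (map (λ u → if adj G v u then 1 else 0) (allFin (n G)))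

data WalkIn (G : Graph) (P : Fin (n G) → Set) :
       Fin (n G) → Fin (n G) → ℕ → Set where
  nil  : ∀ {u} → P u → WalkIn G P u u 0
  cons : ∀ {u w v k} → P u → Adj G u w → WalkIn G P w v k →
         WalkIn G P u v (suc k)

Any𝕍 : (G : Graph) → Fin (n G) → Set
Any𝕍 G _ = Fin 1

DistLe : (G : Graph) → Fin (n G) → Fin (n G) → ℕ → Set
DistLe G u v k = Σ ℕ λ m → m ℕ.≤ k × WalkIn G (Any𝕍 G) u v m

ConnIn : (G : Graph) → (Fin (n G) → Set) → Fin (n G) → Fin (n G) → Set
ConnIn G P u v = Σ ℕ λ k → WalkIn G P u v k

Connected-without : (G : Graph) → List (Fin (n G)) → Set
Connected-without G X =
  ∀ u v → u ∉ X → v ∉ X → ConnIn G (λ w → w ∉ X) u v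

KConnected : ℕ → Graph → Set
KConnected k G =
  k ℕ.< n G × (∀ (X : List (Fin (n G))) → length X ℕ.< k → Connected-without G X)

NonComplete : Graph → Set
NonComplete G = Σ (Fin (n G)) λ u → Σ (Fin (n G)) λ v → u ≢ v × adj G u v ≡ false

S5 : (G : Graph) → Fin (n G) → Set
S5 G v = degree G v ℕ.< 5

DistinctComps : (G : Graph) → Fin (n G) → Fin (n G) → Set
DistinctComps G u v = S5 G u × S5 G v × ¬ ConnIn G (S5 G) u v

-- d(S_5) = d (for d ≥ 1): G[S_5] has two distinct components at
-- distance d, and no two distinct components are at distance < d.
-- (The distance between components is the minimum distance in G
-- between their vertices.)
dS5≡ : Graph → ℕ → Set
dS5≡ G zero = ¬ (Σ (Fin (n G)) λ u → Σ (Fin (n G)) λ v → DistinctComps G u v)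
dS5≡ G (suc d) =
  (Σ (Fin (n G)) λ u → Σ (Fin (n G)) λ v → DistinctComps G u v × DistLe G u v (suc d))
  × (∀ u v → DistinctComps G u v → ¬ DistLe G u v d)

-- Planarity, via a straight-line drawing with integer coordinates
-- (planar ⇔ such a drawing exists, by Fáry's theorem).

Point : Set
Point = ℤ × ℤ

orient : Point → Point → Point → ℤ
orient (ax , ay) (bx , by) (cx , cy) =
  ((bx - ax) * (cy - ay)) - ((by - ay) * (cx - ax))

OnSeg : Point → Point → Point → Set
OnSeg p@(px , py) a@(ax , ay) b@(bx , by) =
  orient a b p ≡ 0ℤ × (((ax - px) * (bx - px)) ℤ.+ ((ay - py) * (by - py))) ≤ 0ℤ

SegIntersect : Point → Point → Point → Point → Set
SegIntersect a b c d =
  ((orient a b c * orient a b d) < 0ℤ × (orient c d a * orient c d b) < 0ℤ)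
  ⊎ OnSeg c a b ⊎ OnSeg d a b ⊎ OnSeg a c d ⊎ OnSeg b c d

record PlaneDrawing (G : Graph) : Set where
  field
    pos        : Fin (n G) → Point
    injective  : ∀ u v → pos u ≡ pos v → u ≡ v
    vertexFree : ∀ a b v → Adj G a b → v ≢ a → v ≢ b →
                 ¬ OnSeg (pos v) (pos a) (pos b)
    edgesFree  : ∀ a b c d → Adj G a b → Adj G c d →
                 a ≢ c → a ≢ d → b ≢ c → b ≢ d →
                 ¬ SegIntersect (pos a) (pos b) (pos c) (pos d)

Planar : Graph → Set
Planar G = PlaneDrawing G

ListAssignment : Graph → Set
ListAssignment G = Fin (n G) → List ℕ

SizeMinDeg5 : (G : Graph) → ListAssignment G → Set
SizeMinDeg5 G L = ∀ v → Unique (L v) × length (L v) ≡ degree G v ⊓ 5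

LColorable : (G : Graph) → ListAssignment G → Set
LColorable G L = Σ (Fin (n G) → ℕ) λ φ →
  (∀ v → φ v ∈ L v) × (∀ u v → Adj G u v → φ u ≢ φ v)

{-# OPTIONS --safe #-}
-- Two adjacent hubs are joined to every vertex of a path, the rim, and each triangle formed by a hub and a
-- link of the rim contains a trap: an octahedron on that triangle with a vertex of degree three, the tip, in
-- its central face. The lists of the three inner vertices of the octahedron and of the tip can be chosen such
-- that one prescribed colouring of the outer triangle does not extend: each inner vertex loses the colours of
-- its two outer neighbours, which leaves the three colours of the list of the tip. The hubs and the rim have
-- the list 0, …, 4. For each of the 20 colourings of the hubs, the six traps along three consecutive links
-- reduce the three colours that are possible on the rim to two, to one and to none. The components of G[S₅]
-- are the tips, and a path between two tips leaves the first octahedron and enters the second one, so that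
-- it has length at least four. Every vertex outside one triangle has three paths to earlier vertices that are
-- disjoint apart from it, so that no two vertices separate it from that triangle.
module Submission where

open import Defs
open import Data.Bool as Bool using (Bool; true; false; if_then_else_; _∧_; _∨_)
open import Data.Bool.ListAction using (any)
open import Data.Bool.Properties as Bool using (∨-comm; T-≡)
open import Data.Empty using (⊥; ⊥-elim)
open import Data.Fin as Fin using (Fin; toℕ)
open import Data.Fin.Properties as Fin using (toℕ<n; toℕ-injective; toℕ-fromℕ<; pigeonhole)
open import Data.Integer as ℤ using (ℤ; +_; -[1+_]; 0ℤ; _-_; _*_)
import Data.Integer.Properties as ℤ
open import Data.Integer.Tactic.RingSolver using (solve-∀)
open import Data.List
  using (List; []; _∷_; map; filter; length; lookup; allFin; tabulate; applyUpTo; upTo; concatMap)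
open import Data.List.Properties using (map-tabulate)
open import Data.List.Membership.Propositional using (_∈_; _∉_; find; lose)
open import Data.List.Membership.Propositional.Properties
  using (∈-filter⁺; ∈-upTo⁺; ∈-allFin; ∈-map⁺; ∈-concatMap⁺)
open import Data.List.Membership.DecPropositional using (_∈?_)
open import Data.List.Relation.Unary.All as All using (All; []; _∷_)
open import Data.List.Relation.Unary.Any as Any using (Any)
open import Data.List.Relation.Unary.Any.Properties using (any⁻; lookup-index)
open import Data.List.Relation.Unary.Unique.Propositional using (Unique)
open import Data.List.Relation.Unary.Unique.DecPropositional using (unique?)
open import Data.Nat as ℕ using (ℕ; zero; suc; _+_; _∸_; _/_; _%_; _⊓_; _<_; _≤_; _<?_; _≤?_; _≡ᵇ_; _<ᵇ_)
import Data.Nat.Properties as ℕ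
open import Data.Nat.DivMod using (_mod_; m%n<n; m<n⇒m%n≡m)
open import Data.Nat.Induction using (<-rec)
open import Data.Nat.ListAction using (sum)
open import Data.Product using (Σ; ∃; ∃₂; _×_; _,_; proj₁; proj₂; uncurry; swap)
open import Data.Sum using (_⊎_; inj₁; inj₂; [_,_]′)
open import Data.Vec as Vec using (Vec; []; _∷_)
open import Function using (_∘_; id; Equivalence)
open import Relation.Binary.Definitions using (tri<; tri≈; tri>)
open import Relation.Binary.PropositionalEquality
  using (_≡_; _≢_; refl; cong; cong₂; subst; subst₂; trans) renaming (sym to ≡-sym)
open import Relation.Nullary using (¬_; Dec; yes; no; contradiction; ¬?; _×-dec_; _⊎-dec_; _→-dec_)
open import Relation.Nullary.Decidable using (True; ⌊_⌋; toWitness; map′)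
open import Relation.Unary using (Decidable)

-- Proper crossings and separating lines

0<*⁺ : ∀ {i j} → 0ℤ ℤ.< i → 0ℤ ℤ.< j → 0ℤ ℤ.< i * j
0<*⁺ {i} {j} 0<i 0<j = subst (ℤ._< i * j) (ℤ.*-zeroʳ i) (ℤ.*-monoˡ-<-pos i {{ℤ.positive 0<i}} 0<j)

0≤*⁺ : ∀ {i j} → 0ℤ ℤ.≤ i → 0ℤ ℤ.≤ j → 0ℤ ℤ.≤ i * j
0≤*⁺ {i} {j} 0≤i 0≤j = subst (ℤ._≤ i * j) (ℤ.*-zeroʳ i) (ℤ.*-monoˡ-≤-nonNeg i {{ℤ.nonNegative 0≤i}} 0≤j)

neg*neg : ∀ i j → ℤ.- i * ℤ.- j ≡ i * j
neg*neg = solve-∀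

*-neg-signs : ∀ i j → i * j ℤ.< 0ℤ → (0ℤ ℤ.< i × j ℤ.< 0ℤ) ⊎ (i ℤ.< 0ℤ × 0ℤ ℤ.< j)
*-neg-signs i j ij<0 with ℤ.<-cmp 0ℤ i | ℤ.<-cmp 0ℤ j
... | tri< 0<i _ _ | tri> _ _ j<0 = inj₁ (0<i , j<0)
... | tri> _ _ i<0 | tri< 0<j _ _ = inj₂ (i<0 , 0<j)
... | tri≈ _ refl _ | _ = contradiction ij<0 (ℤ.<-irrefl (ℤ.*-zeroˡ j))
... | _ | tri≈ _ refl _ = contradiction ij<0 (ℤ.<-irrefl (ℤ.*-zeroʳ i))
... | tri< 0<i _ _ | tri< 0<j _ _ = contradiction ij<0 (ℤ.<-asym (0<*⁺ 0<i 0<j))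
... | tri> _ _ i<0 | tri> _ _ j<0 = contradiction ij<0
  (ℤ.<-asym (subst (0ℤ ℤ.<_) (neg*neg i j) (0<*⁺ (ℤ.neg-mono-< i<0) (ℤ.neg-mono-< j<0))))

orient-swap : ∀ a b c → orient b a c ≡ ℤ.- orient a b c
orient-swap (ax , ay) (bx , by) (cx , cy) = identity ax ay bx by cx cy
  where
  identity : ∀ ax ay bx by cx cy →
    (ax - bx) * (cy - by) - (ay - by) * (cx - bx) ≡ ℤ.- ((bx - ax) * (cy - ay) - (by - ay) * (cx - ax))
  identity = solve-∀

-- Both sides are, up to the same factor, the value at the point where the lines ab and cd meet of the
-- affine function that defines the line st.
orient-cramer : ∀ a b c d s t →
  orient c d a * orient s t b - orient c d b * orient s t a ≡
  orient a b d * orient s t c - orient a b c * orient s t d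
orient-cramer (ax , ay) (bx , by) (cx , cy) (dx , dy) (sx , sy) (tx , ty) =
  identity ax ay bx by cx cy dx dy sx sy tx ty
  where
  identity : ∀ ax ay bx by cx cy dx dy sx sy tx ty →
    ((dx - cx) * (ay - cy) - (dy - cy) * (ax - cx)) * ((tx - sx) * (by - sy) - (ty - sy) * (bx - sx))
    - ((dx - cx) * (by - cy) - (dy - cy) * (bx - cx)) * ((tx - sx) * (ay - sy) - (ty - sy) * (ax - sx))
    ≡ ((bx - ax) * (dy - ay) - (by - ay) * (dx - ax)) * ((tx - sx) * (cy - sy) - (ty - sy) * (cx - sx))
    - ((bx - ax) * (cy - ay) - (by - ay) * (cx - ax)) * ((tx - sx) * (dy - sy) - (ty - sy) * (dx - sx))
  identity = solve-∀

-- Both sides are the cross product of `b - a` and `d - c`.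
orient-difference : ∀ a b c d → orient c d a - orient c d b ≡ orient a b d - orient a b c
orient-difference (ax , ay) (bx , by) (cx , cy) (dx , dy) = identity ax ay bx by cx cy dx dy
  where
  identity : ∀ ax ay bx by cx cy dx dy →
    ((dx - cx) * (ay - cy) - (dy - cy) * (ax - cx)) - ((dx - cx) * (by - cy) - (dy - cy) * (bx - cx))
    ≡ ((bx - ax) * (dy - ay) - (by - ay) * (dx - ax)) - ((bx - ax) * (cy - ay) - (by - ay) * (cx - ax))
  identity = solve-∀

ProperCross : Point → Point → Point → Point → Set
ProperCross a b c d =
  orient a b c * orient a b d ℤ.< 0ℤ × orient c d a * orient c d b ℤ.< 0ℤ

orient-product-swap : ∀ a b c d → orient b a c * orient b a d ≡ orient a b c * orient a b d
orient-product-swap a b c d =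
  trans (cong₂ _*_ (orient-swap a b c) (orient-swap a b d)) (neg*neg (orient a b c) (orient a b d))

properCross-flipˡ : ∀ {a b c d} → ProperCross a b c d → ProperCross b a c d
properCross-flipˡ {a} {b} {c} {d} (p , q) =
  subst (ℤ._< 0ℤ) (≡-sym (orient-product-swap a b c d)) p ,
  subst (ℤ._< 0ℤ) (ℤ.*-comm (orient c d a) (orient c d b)) q

properCross-flipʳ : ∀ {a b c d} → ProperCross a b c d → ProperCross a b d c
properCross-flipʳ {a} {b} {c} {d} = swap ∘ properCross-flipˡ {c} {d} {a} {b} ∘ swap

-- The asymmetry puts an edge inside the line on the nonpositive side only, so that an edge on the
-- other side has an end strictly off the line.
NonPosSide PosSide : Point → Point → Point → Point → Set
NonPosSide s t a b = orient s t a ℤ.≤ 0ℤ × orient s t b ℤ.≤ 0ℤ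
PosSide s t a b = (0ℤ ℤ.≤ orient s t a × 0ℤ ℤ.≤ orient s t b) × (0ℤ ℤ.< orient s t a ⊎ 0ℤ ℤ.< orient s t b)

positive-combination≢0 : ∀ {p q r s x y z w} →
  0ℤ ℤ.< p → 0ℤ ℤ.< q → 0ℤ ℤ.< r → 0ℤ ℤ.< s →
  0ℤ ℤ.≤ x → 0ℤ ℤ.≤ y → 0ℤ ℤ.≤ z → 0ℤ ℤ.≤ w → 0ℤ ℤ.< z ⊎ 0ℤ ℤ.< w →
  p * x ℤ.+ q * y ℤ.+ (r * z ℤ.+ s * w) ≢ 0ℤ
positive-combination≢0 0<p 0<q 0<r 0<s 0≤x 0≤y 0≤z 0≤w 0<z⊎0<w eq =
  ℤ.<-irrefl (≡-sym eq) (ℤ.+-mono-≤-<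
    (ℤ.+-mono-≤ (0≤*⁺ (ℤ.<⇒≤ 0<p) 0≤x) (0≤*⁺ (ℤ.<⇒≤ 0<q) 0≤y))
    ([ (λ 0<z → ℤ.+-mono-<-≤ (0<*⁺ 0<r 0<z) (0≤*⁺ (ℤ.<⇒≤ 0<s) 0≤w))
     , (λ 0<w → ℤ.+-mono-≤-< (0≤*⁺ (ℤ.<⇒≤ 0<r) 0≤z) (0<*⁺ 0<s 0<w)) ]′ 0<z⊎0<w))

-- A proper crossing allows four sign patterns. Two contradict `orient-difference`; in the other
-- two, `orient-cramer` makes a sum of nonnegative terms vanish although one of them is positive.
separated⇒¬properCross : ∀ {s t a b c d} → NonPosSide s t a b → PosSide s t c d → ¬ ProperCross a b c d
separated⇒¬properCross {s} {t} {a} {b} {c} {d} (ℓa≤0 , ℓb≤0) ((0≤ℓc , 0≤ℓd) , 0<ℓcd) (cross₁ , cross₂)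
  with *-neg-signs (orient a b c) (orient a b d) cross₁ | *-neg-signs (orient c d a) (orient c d b) cross₂
... | inj₁ (0<oc , od<0) | inj₁ (0<oa , ob<0) = contradiction
  (subst (0ℤ ℤ.<_) (orient-difference a b c d) (ℤ.+-mono-< 0<oa (ℤ.neg-mono-< ob<0)))
  (ℤ.<-asym (ℤ.+-mono-< od<0 (ℤ.neg-mono-< 0<oc)))
... | inj₂ (oc<0 , 0<od) | inj₂ (oa<0 , 0<ob) = contradiction
  (subst (ℤ._< 0ℤ) (orient-difference a b c d) (ℤ.+-mono-< oa<0 (ℤ.neg-mono-< 0<ob)))
  (ℤ.<-asym (ℤ.+-mono-< 0<od (ℤ.neg-mono-< oc<0)))
... | inj₂ (oc<0 , 0<od) | inj₁ (0<oa , ob<0) = positive-combination≢0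
  0<oa (ℤ.neg-mono-< ob<0) 0<od (ℤ.neg-mono-< oc<0)
  (ℤ.neg-mono-≤ ℓb≤0) (ℤ.neg-mono-≤ ℓa≤0) 0≤ℓc 0≤ℓd 0<ℓcd
  (trans (rearrange (orient c d a) (orient c d b) (orient a b c) (orient a b d)
             (orient s t a) (orient s t b) (orient s t c) (orient s t d))
    (ℤ.i≡j⇒i-j≡0 (≡-sym (orient-cramer a b c d s t))))
  where
  rearrange : ∀ oa ob oc od ℓa ℓb ℓc ℓd →
    oa * ℤ.- ℓb ℤ.+ ℤ.- ob * ℤ.- ℓa ℤ.+ (od * ℓc ℤ.+ ℤ.- oc * ℓd)
    ≡ (od * ℓc - oc * ℓd) - (oa * ℓb - ob * ℓa)
  rearrange = solve-∀
... | inj₁ (0<oc , od<0) | inj₂ (oa<0 , 0<ob) = positive-combination≢0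
  (ℤ.neg-mono-< oa<0) 0<ob (ℤ.neg-mono-< od<0) 0<oc
  (ℤ.neg-mono-≤ ℓb≤0) (ℤ.neg-mono-≤ ℓa≤0) 0≤ℓc 0≤ℓd 0<ℓcd
  (trans (rearrange (orient c d a) (orient c d b) (orient a b c) (orient a b d)
             (orient s t a) (orient s t b) (orient s t c) (orient s t d))
    (ℤ.i≡j⇒i-j≡0 (orient-cramer a b c d s t)))
  where
  rearrange : ∀ oa ob oc od ℓa ℓb ℓc ℓd →
    ℤ.- oa * ℤ.- ℓb ℤ.+ ob * ℤ.- ℓa ℤ.+ (ℤ.- od * ℓc ℤ.+ oc * ℓd)
    ≡ (oa * ℓb - ob * ℓa) - (od * ℓc - oc * ℓd)
  rearrange = solve-∀

0≤i*i : ∀ i → 0ℤ ℤ.≤ i * i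
0≤i*i i with ℤ.≤-total 0ℤ i
... | inj₁ 0≤i = 0≤*⁺ 0≤i 0≤i
... | inj₂ i≤0 = subst (0ℤ ℤ.≤_) (neg*neg i i) (0≤*⁺ (ℤ.neg-mono-≤ i≤0) (ℤ.neg-mono-≤ i≤0))

i<j⇒0<j-i : ∀ {i j} → i ℤ.< j → 0ℤ ℤ.< j - i
i<j⇒0<j-i {i} {j} i<j = subst (ℤ._< j - i) (ℤ.+-inverseʳ i) (ℤ.+-monoˡ-< (ℤ.- i) i<j)

-- The first equation makes `α * B²` nonpositive, hence `B²` too; the second one makes `m² * B²` at
-- least `β * β`, which is positive.
parallel-opposed-impossible : ∀ α β γ δ A·B B² m² →
  0ℤ ℤ.< α → 0ℤ ℤ.< β → 0ℤ ℤ.≤ m² → δ ≡ 0ℤ → A·B ℤ.≤ 0ℤ →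
  α * B² ≡ β * A·B ℤ.+ γ * ℤ.- δ → β * β ℤ.+ γ * γ ≡ m² * B² → ⊥
parallel-opposed-impossible α β γ _ A·B B² m² 0<α 0<β 0≤m² refl A·B≤0 eq₁ eq₂ =
  ℤ.<⇒≱ 0<m²B² (subst (m² * B² ℤ.≤_) (ℤ.*-zeroʳ m²) (ℤ.*-monoˡ-≤-nonNeg m² {{ℤ.nonNegative 0≤m²}} B²≤0))
  where
  αB²≤0 : α * B² ℤ.≤ 0ℤ
  αB²≤0 = begin
    α * B²                ≡⟨ eq₁ ⟩
    β * A·B ℤ.+ γ * 0ℤ    ≡⟨ cong (λ z → β * A·B ℤ.+ z) (ℤ.*-zeroʳ γ) ⟩
    β * A·B ℤ.+ 0ℤ        ≡⟨ ℤ.+-identityʳ (β * A·B) ⟩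
    β * A·B               ≤⟨ ℤ.*-monoˡ-≤-nonNeg β {{ℤ.nonNegative (ℤ.<⇒≤ 0<β)}} A·B≤0 ⟩
    β * 0ℤ                ≡⟨ ℤ.*-zeroʳ β ⟩
    0ℤ                    ∎
    where open ℤ.≤-Reasoning

  B²≤0 : B² ℤ.≤ 0ℤ
  B²≤0 = ℤ.≮⇒≥ (λ 0<B² → ℤ.<⇒≱ (0<*⁺ 0<α 0<B²) αB²≤0)

  0<m²B² : 0ℤ ℤ.< m² * B²
  0<m²B² = subst (0ℤ ℤ.<_) eq₂ (ℤ.+-mono-<-≤ (0<*⁺ 0<β 0<β) (0≤i*i γ))

-- With A = a - p, B = b - p and m the gradient of the affine function of the line st, so that
-- α = m·A and β = m·B: if A and B are parallel then α |B|² = β (A·B), and β² ≤ |m|² |B|².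
onSeg-gradient : (p a b s t : Point) →
  let ℓ = orient s t
      (px , py) = p ; (ax , ay) = a ; (bx , by) = b ; (sx , sy) = s ; (tx , ty) = t
      B² = (bx - px) * (bx - px) ℤ.+ (by - py) * (by - py)
      m² = (tx - sx) * (tx - sx) ℤ.+ (ty - sy) * (ty - sy)
      A·B = (ax - px) * (bx - px) ℤ.+ (ay - py) * (by - py)
      γ = (tx - sx) * (bx - px) ℤ.+ (ty - sy) * (by - py)
  in (ℓ a - ℓ p) * B² ≡ (ℓ b - ℓ p) * A·B ℤ.+ γ * ℤ.- orient a b p
   × (ℓ b - ℓ p) * (ℓ b - ℓ p) ℤ.+ γ * γ ≡ m² * B²
onSeg-gradient (px , py) (ax , ay) (bx , by) (sx , sy) (tx , ty) =
  identity₁ px py ax ay bx by sx sy tx ty , identity₂ px py bx by sx sy tx ty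
  where
  identity₁ : ∀ px py ax ay bx by sx sy tx ty →
    (((tx - sx) * (ay - sy) - (ty - sy) * (ax - sx)) - ((tx - sx) * (py - sy) - (ty - sy) * (px - sx)))
      * ((bx - px) * (bx - px) ℤ.+ (by - py) * (by - py))
    ≡ (((tx - sx) * (by - sy) - (ty - sy) * (bx - sx)) - ((tx - sx) * (py - sy) - (ty - sy) * (px - sx)))
      * ((ax - px) * (bx - px) ℤ.+ (ay - py) * (by - py))
      ℤ.+ ((tx - sx) * (bx - px) ℤ.+ (ty - sy) * (by - py)) * ℤ.- ((bx - ax) * (py - ay) - (by - ay) * (px - ax))
  identity₁ = solve-∀
  identity₂ : ∀ px py bx by sx sy tx ty →
    (((tx - sx) * (by - sy) - (ty - sy) * (bx - sx)) - ((tx - sx) * (py - sy) - (ty - sy) * (px - sx)))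
    * (((tx - sx) * (by - sy) - (ty - sy) * (bx - sx)) - ((tx - sx) * (py - sy) - (ty - sy) * (px - sx)))
      ℤ.+ ((tx - sx) * (bx - px) ℤ.+ (ty - sy) * (by - py)) * ((tx - sx) * (bx - px) ℤ.+ (ty - sy) * (by - py))
    ≡ ((tx - sx) * (tx - sx) ℤ.+ (ty - sy) * (ty - sy)) * ((bx - px) * (bx - px) ℤ.+ (by - py) * (by - py))
  identity₂ = solve-∀

-- The affine function of the line `st` grows strictly from `p` to `a` and from `p` to `b`, whereas
-- on a segment these two directions are opposite.
separated⇒¬OnSeg : ∀ {s t p a b} →
  orient s t p ℤ.< 0ℤ → 0ℤ ℤ.≤ orient s t a → 0ℤ ℤ.≤ orient s t b → ¬ OnSeg p a b
separated⇒¬OnSeg {s@(sx , sy)} {t@(tx , ty)} {p@(px , py)} {a@(ax , ay)} {b@(bx , by)} ℓp<0 0≤ℓa 0≤ℓb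
  (collinear , A·B≤0) = parallel-opposed-impossible
    (orient s t a - orient s t p) (orient s t b - orient s t p)
    ((tx - sx) * (bx - px) ℤ.+ (ty - sy) * (by - py)) (orient a b p)
    ((ax - px) * (bx - px) ℤ.+ (ay - py) * (by - py))
    ((bx - px) * (bx - px) ℤ.+ (by - py) * (by - py))
    ((tx - sx) * (tx - sx) ℤ.+ (ty - sy) * (ty - sy))
    (i<j⇒0<j-i (ℤ.<-≤-trans ℓp<0 0≤ℓa)) (i<j⇒0<j-i (ℤ.<-≤-trans ℓp<0 0≤ℓb))
    (ℤ.+-mono-≤ (0≤i*i (tx - sx)) (0≤i*i (ty - sy))) collinear A·B≤0
    (proj₁ (onSeg-gradient p a b s t)) (proj₂ (onSeg-gradient p a b s t))

-- Binary space partitions as certificates of planarity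

data Partition : Set where
  leaf : Partition
  cut  : Point → Point → Partition → Partition → Partition

dot : Point → Point → Point → ℤ
dot (px , py) (ax , ay) (bx , by) = (ax - px) * (bx - px) ℤ.+ (ay - py) * (by - py)

module _ (pos : ℕ → Point) where

  Edge : Set
  Edge = ℕ × ℕ

  Below Above : Point → Point → Edge → Set
  Below s t (a , b) = NonPosSide s t (pos a) (pos b)
  Above s t (a , b) = PosSide s t (pos a) (pos b)

  below? : ∀ s t → Decidable (Below s t)
  below? s t (a , b) = orient s t (pos a) ℤ.≤? 0ℤ ×-dec orient s t (pos b) ℤ.≤? 0ℤ

  above? : ∀ s t → Decidable (Above s t)
  above? s t (a , b) =
    (0ℤ ℤ.≤? orient s t (pos a) ×-dec 0ℤ ℤ.≤? orient s t (pos b))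
    ×-dec (0ℤ ℤ.<? orient s t (pos a) ⊎-dec 0ℤ ℤ.<? orient s t (pos b))

  low? : ∀ s t → Decidable (λ v → orient s t (pos v) ℤ.≤ 0ℤ)
  low? s t v = orient s t (pos v) ℤ.≤? 0ℤ

  high? : ∀ s t → Decidable (λ v → 0ℤ ℤ.≤ orient s t (pos v))
  high? s t v = 0ℤ ℤ.≤? orient s t (pos v)

  EdgesClear : Edge → Edge → Set
  EdgesClear (a , b) (c , d) =
    ((a ≡ c ⊎ a ≡ d) ⊎ (b ≡ c ⊎ b ≡ d))
    ⊎ 0ℤ ℤ.≤ orient (pos a) (pos b) (pos c) * orient (pos a) (pos b) (pos d)
    ⊎ 0ℤ ℤ.≤ orient (pos c) (pos d) (pos a) * orient (pos c) (pos d) (pos b)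

  VertexClear : Edge → ℕ → Set
  VertexClear (a , b) v = v ≡ a ⊎ v ≡ b ⊎ orient (pos a) (pos b) (pos v) ≢ 0ℤ ⊎ 0ℤ ℤ.< dot (pos v) (pos a) (pos b)

  edgesClear? : ∀ e f → Dec (EdgesClear e f)
  edgesClear? (a , b) (c , d) =
    ((a ℕ.≟ c ⊎-dec a ℕ.≟ d) ⊎-dec (b ℕ.≟ c ⊎-dec b ℕ.≟ d))
    ⊎-dec 0ℤ ℤ.≤? orient (pos a) (pos b) (pos c) * orient (pos a) (pos b) (pos d)
    ⊎-dec 0ℤ ℤ.≤? orient (pos c) (pos d) (pos a) * orient (pos c) (pos d) (pos b)

  vertexClear? : ∀ e v → Dec (VertexClear e v)
  vertexClear? (a , b) v = v ℕ.≟ a ⊎-dec v ℕ.≟ b ⊎-dec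
    ¬? (orient (pos a) (pos b) (pos v) ℤ.≟ 0ℤ) ⊎-dec 0ℤ ℤ.<? dot (pos v) (pos a) (pos b)

  -- No edge crosses a cut, so only edges within one leaf are compared. A vertex on a cutting line
  -- is kept on both sides, an edge inside it only on the lower one.
  data Certifies : Partition → List Edge → List ℕ → Set where
    leaf : ∀ {es vs} → All (λ e → All (EdgesClear e) es × All (VertexClear e) vs) es → Certifies leaf es vs
    cut  : ∀ {s t l r es vs} → All (λ e → Below s t e ⊎ Above s t e) es →
      Certifies l (filter (below? s t) es) (filter (low? s t) vs) →
      Certifies r (filter (above? s t) es) (filter (high? s t) vs) →
      Certifies (cut s t l r) es vs

  certifies? : ∀ p es vs → Dec (Certifies p es vs)
  certifies? leaf          es vs = map′ leaf (λ { (leaf clear) → clear })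
    (All.all? (λ e → All.all? (edgesClear? e) es ×-dec All.all? (vertexClear? e) vs) es)
  certifies? (cut s t l r) es vs =
    map′ (λ (sides , certₗ , certᵣ) → cut sides certₗ certᵣ)
         (λ { (cut sides certₗ certᵣ) → sides , certₗ , certᵣ })
    (All.all? (λ e → below? s t e ⊎-dec above? s t e) es ×-dec
     certifies? l (filter (below? s t) es) (filter (low? s t) vs) ×-dec
     certifies? r (filter (above? s t) es) (filter (high? s t) vs))

  no-crossing : ∀ {p es vs a b c d} → Certifies p es vs → (a , b) ∈ es → (c , d) ∈ es →
    a ≢ c → a ≢ d → b ≢ c → b ≢ d → ¬ ProperCross (pos a) (pos b) (pos c) (pos d)
  no-crossing (leaf clear) e∈ f∈ a≢c a≢d b≢c b≢d (cross₁ , cross₂)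
    with All.lookup (proj₁ (All.lookup clear e∈)) f∈
  ... | inj₁ common        = [ [ a≢c , a≢d ]′ , [ b≢c , b≢d ]′ ]′ common
  ... | inj₂ (inj₁ 0≤prod) = ℤ.<⇒≱ cross₁ 0≤prod
  ... | inj₂ (inj₂ 0≤prod) = ℤ.<⇒≱ cross₂ 0≤prod
  no-crossing {a = a} {b} {c} {d} (cut {s} {t} sides certₗ certᵣ) e∈ f∈ a≢c a≢d b≢c b≢d
    with All.lookup sides e∈ | All.lookup sides f∈
  ... | inj₁ e↓ | inj₁ f↓ = no-crossing certₗ
    (∈-filter⁺ (below? s t) e∈ e↓) (∈-filter⁺ (below? s t) f∈ f↓) a≢c a≢d b≢c b≢d
  ... | inj₂ e↑ | inj₂ f↑ = no-crossing certᵣ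
    (∈-filter⁺ (above? s t) e∈ e↑) (∈-filter⁺ (above? s t) f∈ f↑) a≢c a≢d b≢c b≢d
  ... | inj₁ e↓ | inj₂ f↑ = separated⇒¬properCross {s} {t} {pos a} {pos b} {pos c} {pos d} e↓ f↑
  ... | inj₂ e↑ | inj₁ f↓ = separated⇒¬properCross {s} {t} {pos c} {pos d} {pos a} {pos b} f↓ e↑ ∘ swap

  no-incidence : ∀ {p es vs a b v} → Certifies p es vs → (a , b) ∈ es → v ∈ vs → v ≢ a → v ≢ b →
    ¬ OnSeg (pos v) (pos a) (pos b)
  no-incidence (leaf clear) e∈ v∈ v≢a v≢b onSeg with All.lookup (proj₂ (All.lookup clear e∈)) v∈
  ... | inj₁ v≡a                      = v≢a v≡a
  ... | inj₂ (inj₁ v≡b)               = v≢b v≡b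
  ... | inj₂ (inj₂ (inj₁ off))        = off (proj₁ onSeg)
  ... | inj₂ (inj₂ (inj₂ 0<dot))      = ℤ.<⇒≱ 0<dot (proj₂ onSeg)
  no-incidence {a = a} {b} {v} (cut {s} {t} sides certₗ certᵣ) e∈ v∈ v≢a v≢b
    with All.lookup sides e∈ | low? s t v | high? s t v
  ... | inj₁ e↓ | yes low | _ = no-incidence certₗ
    (∈-filter⁺ (below? s t) e∈ e↓) (∈-filter⁺ (low? s t) v∈ low) v≢a v≢b
  ... | inj₂ e↑ | _ | yes high = no-incidence certᵣ
    (∈-filter⁺ (above? s t) e∈ e↑) (∈-filter⁺ (high? s t) v∈ high) v≢a v≢b
  ... | inj₂ ((0≤ℓa , 0≤ℓb) , _) | _ | no ¬high =
    separated⇒¬OnSeg {s} {t} {pos v} {pos a} {pos b} (ℤ.≰⇒> ¬high) 0≤ℓa 0≤ℓb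
  -- Exchanging `s` and `t` turns the nonpositive side into the nonnegative one.
  ... | inj₁ (ℓa≤0 , ℓb≤0) | no ¬low | _ = separated⇒¬OnSeg {t} {s} {pos v} {pos a} {pos b}
    (subst (ℤ._< 0ℤ) (≡-sym (orient-swap s t (pos v))) (ℤ.neg-mono-< (ℤ.≰⇒> ¬low)))
    (subst (0ℤ ℤ.≤_) (≡-sym (orient-swap s t (pos a))) (ℤ.neg-mono-≤ ℓa≤0))
    (subst (0ℤ ℤ.≤_) (≡-sym (orient-swap s t (pos b))) (ℤ.neg-mono-≤ ℓb≤0))

-- Walks

walk-start : ∀ {G P u v m} → WalkIn G P u v m → P u
walk-start (nil p)      = p
walk-start (cons p _ _) = p

ConnIn-trans : ∀ {G P u v w} → ConnIn G P u v → ConnIn G P v w → ConnIn G P u w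
ConnIn-trans (_ , nil _)          vw = vw
ConnIn-trans (_ , cons p e walk) vw = _ , cons p e (proj₂ (ConnIn-trans (_ , walk) vw))

ConnIn-edge : ∀ {G P u v} → P u → P v → Adj G u v → ConnIn G P u v
ConnIn-edge p q e = 1 , cons p e (nil q)

ConnIn-sym : ∀ {G P u v} → ConnIn G P u v → ConnIn G P v u
ConnIn-sym (_ , nil p) = 0 , nil p
ConnIn-sym {G} (_ , cons {u} {w} p e walk) =
  ConnIn-trans (ConnIn-sym (_ , walk)) (ConnIn-edge (walk-start walk) p (trans (Graph.sym G w u) e))

-- The graph and its lists

-- Settles finite checks by evaluation. The facts obtained from it are `abstract`, so that they are
-- not unfolded again.
byExhaustion : ∀ {P : ℕ → Set} (P? : Decidable P) n → True (All.all? P? (upTo n)) → ∀ {v} → v < n → P v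
byExhaustion P? n holds v<n = All.lookup (toWitness holds) (∈-upTo⁺ v<n)

-- In a trap, the indices 0, 1, 2 are the inner vertices of the octahedron that are opposite to the hub and to
-- the left and right rim vertices, and the index 3 is the tip.
data Role : Set where
  hub    : ℕ → Role
  rim    : ℕ → Role
  corner : (trap index : ℕ) → Role

-- The 20 colourings of the hubs need three links each. The 60 links give 61 rim vertices and 120
-- traps: 63 = 2 + 61 and 543 = 63 + 4 · 120.
order rimStart trapStart : ℕ
order = 543
rimStart = 2
trapStart = 63

role : ℕ → Role
role v = if v <ᵇ rimStart then hub v else if v <ᵇ trapStart then rim (v ∸ rimStart)
  else corner ((v ∸ trapStart) / 4) ((v ∸ trapStart) % 4)

rimVertex : ℕ → ℕ
rimVertex i = rimStart + i

trapVertex : ℕ → ℕ → ℕ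
trapVertex k j = trapStart + (k ℕ.* 4 + j)

-- Trap k sits in the triangle formed by these three vertices.
hubOf leftOf rightOf : ℕ → ℕ
hubOf k = k % 2
leftOf k = rimVertex (k / 2)
rightOf k = rimVertex (suc (k / 2))

-- Every edge is listed at one of its ends.
neighbours : Role → List ℕ
neighbours (hub 0)       = []
neighbours (hub _)       = 0 ∷ []
neighbours (rim 0)       = 0 ∷ 1 ∷ []
neighbours (rim (suc i)) = 0 ∷ 1 ∷ rimVertex i ∷ []
neighbours (corner k 0)  = leftOf k ∷ rightOf k ∷ trapVertex k 1 ∷ []
neighbours (corner k 1)  = hubOf k ∷ rightOf k ∷ trapVertex k 2 ∷ []
neighbours (corner k 2)  = hubOf k ∷ leftOf k ∷ trapVertex k 0 ∷ []
neighbours (corner k _)  = trapVertex k 0 ∷ trapVertex k 1 ∷ trapVertex k 2 ∷ []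

out : ℕ → List ℕ
out v = neighbours (role v)

adjacent : ℕ → ℕ → Bool
adjacent u v = any (v ≡ᵇ_) (out u) ∨ any (u ≡ᵇ_) (out v)

-- Enumerates the ordered pairs of distinct colours below 5; `d` numbers the four colours other than
-- `p`.
hubColours : ℕ → ℕ × ℕ
hubColours g = p , (if d <ᵇ p then d else suc d)
  where
  p = g / 4
  d = g % 4

otherColours : ℕ → ℕ → List ℕ
otherColours p q = filter (λ c → ¬? (c ℕ.≟ p) ×-dec ¬? (c ℕ.≟ q)) (upTo 5)

-- If the two hubs have the colours p and q, then the first link reduces the colours e, f, h possible on
-- the rim to f, h, the second one reduces these to e, and the third one leaves no colour.
forbiddenPair : (step side : ℕ) → List ℕ → ℕ × ℕ
forbiddenPair 0 0 (e ∷ f ∷ h ∷ _) = f , e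
forbiddenPair 0 _ (e ∷ f ∷ h ∷ _) = h , e
forbiddenPair 1 0 (e ∷ f ∷ h ∷ _) = f , h
forbiddenPair 1 _ (e ∷ f ∷ h ∷ _) = h , f
forbiddenPair _ 0 (e ∷ f ∷ h ∷ _) = e , f
forbiddenPair _ _ (e ∷ f ∷ h ∷ _) = e , h
forbiddenPair _ _ _               = 0 , 0

-- The colours of hubOf k, leftOf k and rightOf k that trap k excludes.
forbidden : ℕ → ℕ × ℕ × ℕ
forbidden k = (if k % 2 ≡ᵇ 0 then p else q) , forbiddenPair ((k / 2) % 3) (k % 2) (otherColours p q)
  where
  p = proj₁ (hubColours (k / 6))
  q = proj₂ (hubColours (k / 6))

palette : Role → List ℕ
palette (corner k j) = trapPalette (forbidden k) j
  where
  trapPalette : ℕ × ℕ × ℕ → ℕ → List ℕ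
  trapPalette (π , α , β) 0 = α ∷ β ∷ 5 ∷ 6 ∷ 7 ∷ []
  trapPalette (π , α , β) 1 = π ∷ β ∷ 5 ∷ 6 ∷ 7 ∷ []
  trapPalette (π , α , β) 2 = π ∷ α ∷ 5 ∷ 6 ∷ 7 ∷ []
  trapPalette (π , α , β) _ = 5 ∷ 6 ∷ 7 ∷ []
palette _ = 0 ∷ 1 ∷ 2 ∷ 3 ∷ 4 ∷ []

rowDegree : ℕ → ℕ
rowDegree v = sum (applyUpTo (λ u → if adjacent v u then 1 else 0) order)

adjacent⇒out : ∀ {u v} → adjacent u v ≡ true → v ∈ out u ⊎ u ∈ out v
adjacent⇒out {u} {v} uv with Equivalence.to Bool.T-∨ (Equivalence.from T-≡ uv)
... | inj₁ v∈ = inj₁ (Any.map (ℕ.≡ᵇ⇒≡ v _) (any⁻ (v ≡ᵇ_) (out u) v∈))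
... | inj₂ u∈ = inj₂ (Any.map (ℕ.≡ᵇ⇒≡ u _) (any⁻ (u ≡ᵇ_) (out v) u∈))

adjacent-sym : ∀ u v → adjacent u v ≡ adjacent v u
adjacent-sym u v = ∨-comm (any (v ≡ᵇ_) (out u)) (any (u ≡ᵇ_) (out v))

abstract
  adjacent-irrefl : ∀ {v} → v < order → adjacent v v ≡ false
  adjacent-irrefl = byExhaustion (λ v → adjacent v v Bool.≟ false) order _

trapGraph : Graph
trapGraph = record
  { n      = order
  ; adj    = λ u v → adjacent (toℕ u) (toℕ v)
  ; sym    = λ u v → adjacent-sym (toℕ u) (toℕ v)
  ; irrefl = λ v → adjacent-irrefl (toℕ<n v)
  }

-- Wraps around from `order` on, which is why `Refutes` and `Descends` carry bounds.
at : ℕ → Fin order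
at k = k mod order

toℕ-at : ∀ {k} → k < order → toℕ (at k) ≡ k
toℕ-at {k} k<order = trans (toℕ-fromℕ< (m%n<n k order)) (m<n⇒m%n≡m k<order)

at-toℕ : ∀ v → at (toℕ v) ≡ v
at-toℕ v = toℕ-injective (toℕ-at (toℕ<n v))

Adj-at : ∀ {u v} → u < order → v < order → adjacent u v ≡ true → Adj trapGraph (at u) (at v)
Adj-at u<order v<order uv = trans (cong₂ adjacent (toℕ-at u<order) (toℕ-at v<order)) uv

-- A decision tree: ask v s queries the colour of v and continues with s applied to the answer.
data Strategy : Set where
  stop : Strategy
  ask  : ℕ → (ℕ → Strategy) → Strategy

Assignment : Set
Assignment = List (ℕ × ℕ)

Clash : Assignment → ℕ → ℕ → Set
Clash σ v c = Any (λ (u , d) → c ≡ d × adjacent v u ≡ true) σ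

Refutes : Strategy → Assignment → Set
Refutes stop      σ = ⊥
Refutes (ask v s) σ = v < order × All (λ c → Clash σ v c ⊎ Refutes (s c) ((v , c) ∷ σ)) (palette (role v))

refutes? : ∀ s σ → Dec (Refutes s σ)
refutes? stop      σ = no λ ()
refutes? (ask v s) σ = v <? order ×-dec
  All.all? (λ c → Any.any? (λ (u , d) → c ℕ.≟ d ×-dec adjacent v u Bool.≟ true) σ
                  ⊎-dec refutes? (s c) ((v , c) ∷ σ)) (palette (role v))

paletteOf : ListAssignment trapGraph
paletteOf v = palette (role (toℕ v))

refutes-sound : ∀ s σ → Refutes s σ → (col : LColorable trapGraph paletteOf) →
  All (λ (u , d) → u < order × proj₁ col (at u) ≡ d) σ → ⊥
refutes-sound (ask v s) σ (v<order , refuted) col@(φ , φ∈ , proper) agrees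
  with All.lookup refuted (subst (λ u → φ (at v) ∈ palette (role u)) (toℕ-at v<order) (φ∈ (at v)))
... | inj₂ deeper = refutes-sound (s (φ (at v))) _ deeper col ((v<order , refl) ∷ agrees)
... | inj₁ clash with find clash
...   | _ , ud∈ , c≡d , vu with All.lookup agrees ud∈
...     | u<order , φu≡d = proper _ _ (Adj-at v<order u<order vu) (trans c≡d (≡-sym φu≡d))

-- On the excluded triangle, the three mutually adjacent inner vertices use up 5, 6 and 7 whatever
-- the answers are, and the tip has no colour left.
attackTrap : ℕ → Strategy
attackTrap k = ask (trapVertex k 0) λ _ → ask (trapVertex k 1) λ _ →
  ask (trapVertex k 2) λ _ → ask (trapVertex k 3) λ _ → stop

attackLinks : (steps i : ℕ) → ℕ → Strategy
-- Never reached without an earlier clash: the third link leaves no colour.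
attackLinks zero        i α = stop
attackLinks (suc steps) i α = ask (rimVertex (suc i)) λ β →
  if excludes (i ℕ.* 2) α β then attackTrap (i ℕ.* 2)
  else if excludes (i ℕ.* 2 + 1) α β then attackTrap (i ℕ.* 2 + 1)
  else attackLinks steps (suc i) β
  where
  excludes : ℕ → ℕ → ℕ → Bool
  -- The colour of the hub agrees already, since the links were selected by the colours of the hubs.
  excludes k α β = (proj₁ (proj₂ (forbidden k)) ≡ᵇ α) ∧ (proj₂ (proj₂ (forbidden k)) ≡ᵇ β)

attack : Strategy
attack = ask 0 λ p → ask 1 λ q →
  -- The first of the three links reserved for these hub colours; the bracket inverts `hubColours`
  -- for distinct `p` and `q`.
  let i = 3 ℕ.* (4 ℕ.* p + (if q <ᵇ p then q else q ∸ 1)) in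
  ask (rimVertex i) λ α → attackLinks 3 i α

abstract
  attack-refutes : Refutes attack []
  attack-refutes = toWitness {a? = refutes? attack []} _

¬colourable : ¬ LColorable trapGraph paletteOf
¬colourable col = refutes-sound attack [] attack-refutes col []

-- Degrees and distances

tabulate-toℕ : ∀ {A : Set} (f : ℕ → A) n → tabulate {n = n} (f ∘ toℕ) ≡ applyUpTo f n
tabulate-toℕ f zero    = refl
tabulate-toℕ f (suc n) = cong (f 0 ∷_) (tabulate-toℕ (f ∘ suc) n)

sum-allFin : ∀ (f : ℕ → ℕ) n → sum (map (f ∘ toℕ) (allFin n)) ≡ sum (applyUpTo f n)
sum-allFin f n = cong sum (trans (map-tabulate id (f ∘ toℕ)) (tabulate-toℕ f n))

degree≡rowDegree : ∀ v → degree trapGraph v ≡ rowDegree (toℕ v)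
degree≡rowDegree v = sum-allFin (λ u → if adjacent (toℕ v) u then 1 else 0) order

abstract
  palettes-fit : ∀ {v} → v < order → length (palette (role v)) ≡ rowDegree v ⊓ 5
  palettes-fit = byExhaustion (λ v → length (palette (role v)) ℕ.≟ rowDegree v ⊓ 5) order _

  palettes-unique : ∀ {v} → v < order → Unique (palette (role v))
  palettes-unique = byExhaustion (λ v → unique? ℕ._≟_ (palette (role v))) order _

length-paletteOf : ∀ v → length (paletteOf v) ≡ degree trapGraph v ⊓ 5
length-paletteOf v =
  trans (palettes-fit (toℕ<n v)) (cong (_⊓ 5) (≡-sym (degree≡rowDegree v)))

sizes : SizeMinDeg5 trapGraph paletteOf
sizes v = palettes-unique (toℕ<n v) , length-paletteOf v

-- Stands for degree below 5: the length of a list is the minimum of the degree and 5, and it is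
-- cheaper to evaluate.
Tip : ℕ → Set
Tip v = length (palette (role v)) < 5

tip? : Decidable Tip
tip? v = length (palette (role v)) <? 5

S5⇒Tip : ∀ v → S5 trapGraph v → Tip (toℕ v)
S5⇒Tip v d<5 = subst (_< 5) (≡-sym (length-paletteOf v)) (ℕ.≤-<-trans (ℕ.m⊓n≤m _ 5) d<5)

-- The number of the trap. On hubs and rim the value 0 is meaningless, so `sameHome` asks for both
-- ends to be in traps.
home : ℕ → ℕ
home v = (v ∸ trapStart) / 4

abstract
  tip-position : ∀ {v} → v < order → Tip v → v ≡ trapVertex (home v) 3
  tip-position = byExhaustion (λ v → tip? v →-dec v ℕ.≟ trapVertex (home v) 3) order _

tips-home-injective : ∀ u v → Tip (toℕ u) → Tip (toℕ v) → home (toℕ u) ≡ home (toℕ v) → u ≡ v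
tips-home-injective u v tip-u tip-v eq = toℕ-injective (trans
  (subst (λ k → toℕ u ≡ trapVertex k 3) eq (tip-position (toℕ<n u) tip-u))
  (≡-sym (tip-position (toℕ<n v) tip-v)))

record LocalEdge (u v : ℕ) : Set where
  constructor localEdge
  field
    beyondCore : Tip u ⊎ Tip v → trapStart ≤ u × trapStart ≤ v
    sameHome   : trapStart ≤ u × trapStart ≤ v → home u ≡ home v

open LocalEdge

localEdge-sym : ∀ {u v} → LocalEdge u v → LocalEdge v u
localEdge-sym e = localEdge (swap ∘ beyondCore e ∘ [ inj₂ , inj₁ ]′) (≡-sym ∘ sameHome e ∘ swap)

localEdge? : ∀ u v → Dec (LocalEdge u v)
localEdge? u v = map′ (uncurry localEdge) (λ e → beyondCore e , sameHome e)
  (((tip? u ⊎-dec tip? v) →-dec (trapStart ≤? u ×-dec trapStart ≤? v))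
   ×-dec ((trapStart ≤? u ×-dec trapStart ≤? v) →-dec home u ℕ.≟ home v))

abstract
  out-local : ∀ {u} → u < order → All (LocalEdge u) (out u)
  out-local = byExhaustion (λ u → All.all? (localEdge? u) (out u)) order _

Adj⇒localEdge : ∀ u v → Adj trapGraph u v → LocalEdge (toℕ u) (toℕ v)
Adj⇒localEdge u v uv with adjacent⇒out {toℕ u} {toℕ v} uv
... | inj₁ v∈ = All.lookup (out-local (toℕ<n u)) v∈
... | inj₂ u∈ = localEdge-sym (All.lookup (out-local (toℕ<n v)) u∈)

adjacent-tips-equal : ∀ u v → Tip (toℕ u) → Tip (toℕ v) → Adj trapGraph u v → u ≡ v
adjacent-tips-equal u v tu tv e = tips-home-injective u v tu tv (sameHome l (beyondCore l (inj₁ tu)))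
  where l = Adj⇒localEdge u v e

-- The first and the last edge stay in the traps of their tips. A middle edge then joins two trap
-- vertices, so that both traps are the same.
close-tips-equal : ∀ {P u v m} → Tip (toℕ u) → Tip (toℕ v) → m ≤ 3 → WalkIn trapGraph P u v m → u ≡ v
close-tips-equal tu tv _ (nil _) = refl
close-tips-equal {u = u} {v} tu tv _ (cons _ e (nil _)) = adjacent-tips-equal u v tu tv e
close-tips-equal {u = u} {v} tu tv _ (cons {w = w} _ e₁ (cons _ e₂ (nil _))) =
  tips-home-injective u v tu tv (trans
    (sameHome l₁ (beyondCore l₁ (inj₁ tu))) (sameHome l₂ (beyondCore l₂ (inj₂ tv))))
  where
  l₁ = Adj⇒localEdge u w e₁
  l₂ = Adj⇒localEdge w v e₂
close-tips-equal {u = u} {v} tu tv _ (cons {w = w} _ e₁ (cons {w = x} _ e₂ (cons _ e₃ (nil _)))) =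
  tips-home-injective u v tu tv (trans (sameHome l₁ b₁) (trans
    (sameHome (Adj⇒localEdge w x e₂) (proj₂ b₁ , proj₁ b₃)) (sameHome l₃ b₃)))
  where
  l₁ = Adj⇒localEdge u w e₁
  l₃ = Adj⇒localEdge x v e₃
  b₁ = beyondCore l₁ (inj₁ tu)
  b₃ = beyondCore l₃ (inj₂ tv)
close-tips-equal _ _ (ℕ.s≤s (ℕ.s≤s (ℕ.s≤s ()))) (cons _ _ (cons _ _ (cons _ _ (cons _ _ _))))

S5-isolated : ∀ {u v m} → WalkIn trapGraph (S5 trapGraph) u v m → u ≡ v
S5-isolated (nil _) = refl
S5-isolated (cons {u = u} {w = w} u∈S5 e walk) =
  trans (adjacent-tips-equal u w (S5⇒Tip u u∈S5) (S5⇒Tip w (walk-start walk)) e) (S5-isolated walk)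

Tip⇒S5 : ∀ v → Tip (toℕ v) → S5 trapGraph v
Tip⇒S5 v tip = ℕ.≰⇒> λ 5≤d →
  ℕ.<-irrefl (trans (length-paletteOf v) (ℕ.m≥n⇒m⊓n≡n 5≤d)) tip

distance : dS5≡ trapGraph 4
distance = (tip₀ , tip₁ , distinct , 4 , ℕ.≤-refl , walk) , apart
  where
  tip₀ = at (trapVertex 0 3)
  tip₁ = at (trapVertex 1 3)

  distinct : DistinctComps trapGraph tip₀ tip₁
  distinct =
    Tip⇒S5 tip₀ (toWitness {a? = tip? (toℕ tip₀)} _) ,
    Tip⇒S5 tip₁ (toWitness {a? = tip? (toℕ tip₁)} _) ,
    λ (_ , w) → contradiction (cong toℕ (S5-isolated w)) λ ()

  walk : WalkIn trapGraph (Any𝕍 trapGraph) tip₀ tip₁ 4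
  walk =
    -- Traps 0 and 1 lie on the two sides of the first link, and their corners opposite to the hubs
    -- share its left end.
    cons {w = at (trapVertex 0 0)} Fin.zero refl (cons {w = at (rimVertex 0)} Fin.zero refl
    (cons {w = at (trapVertex 1 0)} Fin.zero refl (cons {w = tip₁} Fin.zero refl (nil Fin.zero))))

  apart : ∀ u v → DistinctComps trapGraph u v → ¬ DistLe trapGraph u v 3
  apart u v (u∈S5 , v∈S5 , ¬conn) (m , m≤3 , w) = ¬conn (subst (ConnIn trapGraph (S5 trapGraph) u)
    (close-tips-equal (S5⇒Tip u u∈S5) (S5⇒Tip v v∈S5) m≤3 w) (0 , nil u∈S5))

nonComplete : NonComplete trapGraph
nonComplete = at (rimVertex 0) , at (rimVertex 2) , (λ eq → contradiction (cong toℕ eq) λ ()) , refl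

-- Connectivity

-- A pair (m , w) stands for the path v - m - w, or for the edge v - w if m = w.
fan : Role → Vec (ℕ × ℕ) 3
fan (rim (suc i)) = (0 , 0) ∷ (1 , 1) ∷ (rimVertex i , rimVertex i) ∷ []
fan (corner k 0)  = (leftOf k , leftOf k) ∷ (rightOf k , rightOf k) ∷ (trapVertex k 1 , hubOf k) ∷ []
fan (corner k 1)  = (hubOf k , hubOf k) ∷ (rightOf k , rightOf k) ∷ (trapVertex k 0 , leftOf k) ∷ []
fan (corner k 2)  = (hubOf k , hubOf k) ∷ (leftOf k , leftOf k) ∷ (trapVertex k 0 , rightOf k) ∷ []
fan (corner k _)  =
  (trapVertex k 0 , leftOf k) ∷ (trapVertex k 1 , rightOf k) ∷ (trapVertex k 2 , hubOf k) ∷ []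
-- A filler for the hubs and the first rim vertex, the three roots that need no fan.
fan _             = Vec.replicate 3 (0 , 0)

spoke : ℕ → Fin 3 → ℕ × ℕ
spoke v = Vec.lookup (fan (role v))

-- Only the far end `w` has to precede `v`; the middle vertex may come later.
Descends : ℕ → ℕ × ℕ → Set
Descends v (m , w) = m < order × w < v × adjacent v m ≡ true × (m ≡ w ⊎ adjacent m w ≡ true)

Disjoint : ℕ × ℕ → ℕ × ℕ → Set
Disjoint (m , w) (m′ , w′) = (m ≢ m′ × m ≢ w′) × (w ≢ m′ × w ≢ w′)

Fan : ℕ → Set
Fan v =
  All (λ i → Descends v (spoke v i)) (allFin 3) ×
  All (λ i → All (λ j → i ≢ j → Disjoint (spoke v i) (spoke v j)) (allFin 3)) (allFin 3)

fan? : Decidable Fan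
fan? v =
  All.all? (λ i → descends? (spoke v i)) (allFin 3) ×-dec
  All.all? (λ i → All.all? (λ j → ¬? (i Fin.≟ j) →-dec disjoint? (spoke v i) (spoke v j)) (allFin 3)) (allFin 3)
  where
  descends? : ∀ p → Dec (Descends v p)
  descends? (m , w) = m <? order ×-dec w <? v ×-dec
    adjacent v m Bool.≟ true ×-dec (m ℕ.≟ w ⊎-dec adjacent m w Bool.≟ true)
  disjoint? : ∀ p q → Dec (Disjoint p q)
  disjoint? (m , w) (m′ , w′) =
    (¬? (m ℕ.≟ m′) ×-dec ¬? (m ℕ.≟ w′)) ×-dec (¬? (w ℕ.≟ m′) ×-dec ¬? (w ℕ.≟ w′))

abstract
  fans : ∀ {v} → v < order → v < 3 ⊎ Fan v
  fans = byExhaustion (λ v → v <? 3 ⊎-dec fan? v) order _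

  roots-adjacent : ∀ {u} → u < 3 → All (λ v → u ≡ v ⊎ adjacent u v ≡ true) (upTo 3)
  roots-adjacent = byExhaustion
    (λ u → All.all? (λ v → u ℕ.≟ v ⊎-dec adjacent u v Bool.≟ true) (upTo 3)) 3 _

module _ (X : List (Fin order)) (|X|<3 : length X < 3) where

  Avoids : ℕ → Set
  Avoids k = at k ∉ X

  avoids? : Decidable Avoids
  avoids? k = ¬? (_∈?_ Fin._≟_ (at k) X)

  AvoidsPair : ℕ × ℕ → Set
  AvoidsPair (m , w) = Avoids m × Avoids w

  Linked : ℕ → ℕ → Set
  Linked u v = ConnIn trapGraph (_∉ X) (at u) (at v)

  link : ∀ u v → u < order → v < order → Avoids u → Avoids v → adjacent u v ≡ true → Linked u v
  link u v u<order v<order u∉X v∉X uv = ConnIn-edge u∉X v∉X (Adj-at u<order v<order uv)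

  hit : ∀ {p} → ¬ AvoidsPair p → ∃ λ i → lookup X i ≡ at (proj₁ p) ⊎ lookup X i ≡ at (proj₂ p)
  hit {m , w} meets with _∈?_ Fin._≟_ (at m) X | _∈?_ Fin._≟_ (at w) X
  ... | yes m∈X | _       = Any.index m∈X , inj₁ (≡-sym (lookup-index m∈X))
  ... | no  _   | yes w∈X = Any.index w∈X , inj₂ (≡-sym (lookup-index w∈X))
  ... | no m∉X  | no w∉X  = contradiction (m∉X , w∉X) meets

  at-injective : ∀ {i j} → i < order → j < order → at i ≡ at j → i ≡ j
  at-injective i<order j<order eq = trans (≡-sym (toℕ-at i<order)) (trans (cong toℕ eq) (toℕ-at j<order))

  -- Three disjoint spokes cannot all be met by two vertices.
  free-spoke : ∀ {v} → v < order → Fan v → ∃ λ i → AvoidsPair (spoke v i)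
  free-spoke {v} v<order (descents , disjointness)
    with Fin.any? (λ i → avoids? (proj₁ (spoke v i)) ×-dec avoids? (proj₂ (spoke v i)))
  ... | yes free = free
  ... | no ¬free = ⊥-elim (clash (pigeonhole |X|<3 (proj₁ ∘ hits)))
    where
    descends : ∀ i → Descends v (spoke v i)
    descends i = All.lookup descents (∈-allFin i)

    disjoint : ∀ i j → i ≢ j → Disjoint (spoke v i) (spoke v j)
    disjoint i j = All.lookup (All.lookup disjointness (∈-allFin i)) (∈-allFin j)

    hits : ∀ i → ∃ λ x → lookup X x ≡ at (proj₁ (spoke v i)) ⊎ lookup X x ≡ at (proj₂ (spoke v i))
    hits i = hit {spoke v i} (λ free → ¬free (i , free))

    m< : ∀ i → proj₁ (spoke v i) < order
    m< i = proj₁ (descends i)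

    w< : ∀ i → proj₂ (spoke v i) < order
    w< i = ℕ.<-trans (proj₁ (proj₂ (descends i))) v<order

    clash : ¬ (∃₂ λ i j → i Fin.< j × proj₁ (hits i) ≡ proj₁ (hits j))
    clash (i , j , i<j , same) with hits i | hits j | disjoint i j (Fin.<⇒≢ i<j)
    clash (i , j , i<j , refl) | _ , p | _ , q | (mm , mw) , (wm , ww) with p | q
    ... | inj₁ p | inj₁ q = mm (at-injective (m< i) (m< j) (trans (≡-sym p) q))
    ... | inj₁ p | inj₂ q = mw (at-injective (m< i) (w< j) (trans (≡-sym p) q))
    ... | inj₂ p | inj₁ q = wm (at-injective (w< i) (m< j) (trans (≡-sym p) q))
    ... | inj₂ p | inj₂ q = ww (at-injective (w< i) (w< j) (trans (≡-sym p) q))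

  RootFrom : ℕ → Set
  RootFrom v = ∃ λ r → r < 3 × Avoids r × Linked v r

  ReachesRoot : ℕ → Set
  ReachesRoot v = v < order → Avoids v → RootFrom v

  -- A spoke that misses `X` leads to an earlier vertex, and the descent ends at a root.
  reachesRoot : ∀ v → ReachesRoot v
  reachesRoot = <-rec ReachesRoot step
    where
    step : ∀ v → (∀ {w} → w < v → ReachesRoot w) → ReachesRoot v
    step v rec v<order v∉X with fans v<order
    ... | inj₁ v<3 = v , v<3 , v∉X , 0 , nil v∉X
    ... | inj₂ fanᵥ with free-spoke v<order fanᵥ
    ...   | i , m∉X , w∉X with All.lookup (proj₁ fanᵥ) (∈-allFin i)
    ...     | m<order , w<v , vm , m≡w⊎mw with rec w<v (ℕ.<-trans w<v v<order) w∉X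
    ...       | r , r<3 , r∉X , w~r =
      r , r<3 , r∉X , ConnIn-trans (link v m v<order m<order v∉X m∉X vm) (ConnIn-trans m~w w~r)
      where
      m = proj₁ (spoke v i)
      w = proj₂ (spoke v i)

      m~w : Linked m w
      m~w = [ (λ m≡w → subst (Linked m) m≡w (0 , nil m∉X))
            , link m w m<order (ℕ.<-trans w<v v<order) m∉X w∉X ]′ m≡w⊎mw

  connected : Connected-without trapGraph X
  connected u v u∉X v∉X = subst₂ (ConnIn trapGraph (_∉ X)) (at-toℕ u) (at-toℕ v)
    (joined (reachesRoot (toℕ u) (toℕ<n u) (avoid u u∉X)) (reachesRoot (toℕ v) (toℕ<n v) (avoid v v∉X)))
    where
    avoid : ∀ u → u ∉ X → Avoids (toℕ u)
    avoid u = subst (_∉ X) (≡-sym (at-toℕ u))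

    joined : RootFrom (toℕ u) → RootFrom (toℕ v) → Linked (toℕ u) (toℕ v)
    joined (r , r<3 , r∉X , u~r) (s , s<3 , s∉X , v~s) = ConnIn-trans u~r (ConnIn-trans r~s (ConnIn-sym v~s))
      where
      3≤order = ℕ.m≤m+n 3 540
      r~s : Linked r s
      r~s with All.lookup (roots-adjacent r<3) (∈-upTo⁺ s<3)
      ... | inj₁ refl = 0 , nil r∉X
      ... | inj₂ rs   = link r s (ℕ.<-≤-trans r<3 3≤order) (ℕ.<-≤-trans s<3 3≤order) r∉X s∉X rs

3-connected : KConnected 3 trapGraph
3-connected = ℕ.m≤m+n 4 539 , connected

-- The drawing

-- Multiples of 15 keep points with weights in fifths or thirds integral. The rim starts at abscissa
-- 15, off the line of the hubs.
hubPoint rimPoint : ℕ → Point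
hubPoint 0 = 0ℤ , + 15
hubPoint _ = 0ℤ , -[1+ 14 ]
rimPoint i = + (15 ℕ.* suc i) , 0ℤ

-- In the triangle of its trap, a corner has the weights 2/5, 2/5, 1/5 in some order and the tip has the
-- weights 1/3, 1/3, 1/3.
trapPoint : (side i index : ℕ) → Point
trapPoint side i j = abscissa j , height side j
  where
  abscissa : ℕ → ℤ
  abscissa 0 = + (6 ℕ.* i + 6 ℕ.* suc i)
  abscissa 1 = + (3 ℕ.* i + 6 ℕ.* suc i)
  abscissa 2 = + (6 ℕ.* i + 3 ℕ.* suc i)
  abscissa _ = + (5 ℕ.* i + 5 ℕ.* suc i)

  height : ℕ → ℕ → ℤ
  height 0 0 = + 3
  height 0 3 = + 5
  height 0 _ = + 6
  height _ 0 = -[1+ 2 ]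
  height _ 3 = -[1+ 4 ]
  height _ _ = -[1+ 5 ]

place : Role → Point
place (hub h)      = hubPoint h
place (rim i)      = rimPoint i
place (corner k j) = trapPoint (k % 2) (suc (k / 2)) j

position : ℕ → Point
position v = place (role v)

-- Bisects the fan of triangles at a hub along the lines from the hub to the rim.
pencil : (ℕ → Partition → Partition → Partition) → (depth first : ℕ) → Partition
pencil ray zero        i = leaf
pencil ray (suc depth) i = ray middle (pencil ray depth i) (pencil ray depth middle)
  where middle = i + 2 ℕ.^ depth

-- The first cut splits off the edge between the hubs, the second one runs along the rim. Depth 6
-- gives 64 sectors for the 60 links on each side. The rays are directed oppositely in the two
-- halves, so that smaller indices are always on the nonpositive side.
partition : Partition
partition = cut (hubPoint 0) (hubPoint 1) leaf (cut (rimPoint 0) (rimPoint 1)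
  (pencil (λ i → cut (rimPoint i) (hubPoint 1)) 6 0)
  (pencil (λ i → cut (hubPoint 0) (rimPoint i)) 6 0))

edgesUpTo : ℕ → List (ℕ × ℕ)
edgesUpTo n = concatMap (λ u → map (u ,_) (out u)) (upTo n)

∈-edgesUpTo⁺ : ∀ {n u v} → u < n → v ∈ out u → (u , v) ∈ edgesUpTo n
∈-edgesUpTo⁺ {n} {u} u<n v∈ =
  ∈-concatMap⁺ (λ u → map (u ,_) (out u)) {upTo n} (lose (∈-upTo⁺ u<n) (∈-map⁺ (u ,_) v∈))

edges : List (ℕ × ℕ)
edges = edgesUpTo order

abstract
  partition-certifies : Certifies position partition edges (upTo order)
  partition-certifies = toWitness {a? = certifies? position partition edges (upTo order)} _

Adj⇒edge : ∀ u v → Adj trapGraph u v → (toℕ u , toℕ v) ∈ edges ⊎ (toℕ v , toℕ u) ∈ edges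
Adj⇒edge u v uv with adjacent⇒out {toℕ u} {toℕ v} uv
... | inj₁ v∈ = inj₁ (∈-edgesUpTo⁺ (toℕ<n u) v∈)
... | inj₂ u∈ = inj₂ (∈-edgesUpTo⁺ (toℕ<n v) u∈)

pos : Fin order → Point
pos v = position (toℕ v)

OnSeg-sym : ∀ p a b → OnSeg p a b → OnSeg p b a
OnSeg-sym p@(px , py) a@(ax , ay) b@(bx , by) (collinear , between) =
  trans (orient-swap a b p) (cong ℤ.-_ collinear) ,
  subst (ℤ._≤ 0ℤ) (cong₂ ℤ._+_ (ℤ.*-comm (ax - px) (bx - px)) (ℤ.*-comm (ay - py) (by - py))) between

off-edges : ∀ a b v → Adj trapGraph a b → v ≢ a → v ≢ b → ¬ OnSeg (pos v) (pos a) (pos b)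
off-edges a b v ab v≢a v≢b onSeg with Adj⇒edge a b ab
... | inj₁ e∈ = no-incidence position partition-certifies e∈ (∈-upTo⁺ (toℕ<n v))
  (v≢a ∘ toℕ-injective) (v≢b ∘ toℕ-injective) onSeg
... | inj₂ e∈ = no-incidence position partition-certifies e∈ (∈-upTo⁺ (toℕ<n v))
  (v≢b ∘ toℕ-injective) (v≢a ∘ toℕ-injective) (OnSeg-sym (pos v) (pos a) (pos b) onSeg)

-- `edges` lists each edge in one direction, whence the flips.
uncrossed : ∀ a b c d → Adj trapGraph a b → Adj trapGraph c d → a ≢ c → a ≢ d → b ≢ c → b ≢ d →
  ¬ ProperCross (pos a) (pos b) (pos c) (pos d)
uncrossed a b c d ab cd a≢c a≢d b≢c b≢d cross with Adj⇒edge a b ab | Adj⇒edge c d cd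
... | inj₁ e∈ | inj₁ f∈ = no-crossing position partition-certifies e∈ f∈
  (a≢c ∘ toℕ-injective) (a≢d ∘ toℕ-injective) (b≢c ∘ toℕ-injective) (b≢d ∘ toℕ-injective) cross
... | inj₂ e∈ | inj₁ f∈ = no-crossing position partition-certifies e∈ f∈
  (b≢c ∘ toℕ-injective) (b≢d ∘ toℕ-injective) (a≢c ∘ toℕ-injective) (a≢d ∘ toℕ-injective)
  (properCross-flipˡ {pos a} {pos b} {pos c} {pos d} cross)
... | inj₁ e∈ | inj₂ f∈ = no-crossing position partition-certifies e∈ f∈
  (a≢d ∘ toℕ-injective) (a≢c ∘ toℕ-injective) (b≢d ∘ toℕ-injective) (b≢c ∘ toℕ-injective)
  (properCross-flipʳ {pos a} {pos b} {pos c} {pos d} cross)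
... | inj₂ e∈ | inj₂ f∈ = no-crossing position partition-certifies e∈ f∈
  (b≢d ∘ toℕ-injective) (b≢c ∘ toℕ-injective) (a≢d ∘ toℕ-injective) (a≢c ∘ toℕ-injective)
  (properCross-flipˡ {pos a} {pos b} {pos d} {pos c} (properCross-flipʳ {pos a} {pos b} {pos c} {pos d} cross))

-- A left inverse of position: injectivity is checked vertex by vertex and not pair by pair.
recover : Point → ℕ
recover (x , y) = decode ℤ.∣ y ∣
  where
  side : ℕ
  side = if ⌊ 0ℤ ℤ.≤? y ⌋ then 0 else 1

  trapAt : ℕ → ℕ
  trapAt i = (i ∸ 1) ℕ.* 2 + side

  decode : ℕ → ℕ
  -- The height determines the kind of vertex. Corners 0, 1, 2 and the tip have the abscissae 12i +
  -- 6, 9i + 6, 9i + 3 and 10i + 5.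
  decode 0  = rimVertex (ℤ.∣ x ∣ / 15 ∸ 1)
  decode 3  = trapVertex (trapAt (ℤ.∣ x ∣ / 12)) 0
  decode 5  = trapVertex (trapAt (ℤ.∣ x ∣ / 10)) 3
  decode 6  = trapVertex (trapAt (ℤ.∣ x ∣ / 9)) (if ℤ.∣ x ∣ % 9 ≡ᵇ 6 then 1 else 2)
  decode _  = side

abstract
  recover-position : ∀ {v} → v < order → recover (position v) ≡ v
  recover-position = byExhaustion (λ v → recover (position v) ℕ.≟ v) order _

pos-injective : ∀ u v → pos u ≡ pos v → u ≡ v
pos-injective u v eq = toℕ-injective (trans (≡-sym (recover-position (toℕ<n u)))
  (trans (cong recover eq) (recover-position (toℕ<n v))))

planar : Planar trapGraph
planar = record
  { pos        = pos
  ; injective  = pos-injective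
  ; vertexFree = off-edges
  ; edgesFree  = λ
    { a b c d ab cd a≢c a≢d b≢c b≢d (inj₁ cross) → uncrossed a b c d ab cd a≢c a≢d b≢c b≢d cross
    -- In each remaining case an end of one edge would lie on the other edge.
    ; a b c d ab cd a≢c a≢d b≢c b≢d (inj₂ (inj₁ onSeg)) →
        off-edges a b c ab (a≢c ∘ ≡-sym) (b≢c ∘ ≡-sym) onSeg
    ; a b c d ab cd a≢c a≢d b≢c b≢d (inj₂ (inj₂ (inj₁ onSeg))) →
        off-edges a b d ab (a≢d ∘ ≡-sym) (b≢d ∘ ≡-sym) onSeg
    ; a b c d ab cd a≢c a≢d b≢c b≢d (inj₂ (inj₂ (inj₂ (inj₁ onSeg)))) → off-edges c d a cd a≢c a≢d onSeg
    ; a b c d ab cd a≢c a≢d b≢c b≢d (inj₂ (inj₂ (inj₂ (inj₂ onSeg)))) → off-edges c d b cd b≢c b≢d onSeg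
    }
  }

theorem9 : Σ Graph λ G → Planar G × KConnected 3 G × NonComplete G × dS5≡ G 4 ×
    (Σ (ListAssignment G) λ L → SizeMinDeg5 G L × ¬ LColorable G L)
theorem9 =
  trapGraph , planar , 3-connected , nonComplete , distance , paletteOf , sizes , ¬colourable
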